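{- The following six mesh patterns $(12,R)$ are pairwise equidistributed, where $R$ ranges over: $\{(1,2),(2,2),(0,1),(1,1)\}$, $\{(1,2),(0,1),(1,1),(0,0)\}$, $\{(2,2),(1,1),(2,1),(1,0)\}$, $\{(1,1),(2,1),(0,0),(1,0)\}$, $\{(2,2),(0,1),(2,1),(0,0)\}$, $\{(1,2),(2,2),(0,0),(1,0)\}$.
   Context: For $R\subseteq\{0,1,2\}^2$ and $\pi=\pi_1\cdots\pi_n\in S_n$, an occurrence of the mesh pattern $(12,R)$ in $\pi$ is a pair of positions $i_1<i_2$ with $\pi_{i_1}<\pi_{i_2}$ such that, setting $x_0=0,x_1=i_1,x_2=i_2,x_3=n+1$ and $y_0=0,y_1=\pi_{i_1},y_2=\pi_{i_2},y_3=n+1$, for every $(a,b)\in R$ there is no index $k$ with $x_a<k<x_{a+1}$ and $y_b<\pi_k<y_{b+1}$. $s_{n,k}(p)$ is the number of $\pi\in S_n$ with exactly $k$ occurrences of $p$; $p_1,p_2$ are equidistributed if $s_{n,k}(p_1)=s_{n,k}(p_2)$ for all $n,k\ge 0$. -}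

module Defs where

open import Data.Nat using (ℕ; zero; suc; _<ᵇ_)
open import Data.Bool using (Bool; true; false; _∧_; not)
open import Data.Fin using (Fin; toℕ; inject₁) renaming (suc to fsuc; zero to fzero)
open import Data.Product using (_×_; _,_)
open import Data.List using (List; []; _∷_; length; filter; map; concatMap; zip; upTo; foldr)
open import Data.Bool.ListAction using (all; any)
open import Data.Vec using (Vec; lookup; toList) renaming ([] to []ᵥ; _∷_ to _∷ᵥ_)
open import Data.List.Membership.Propositional using (_∈_)
open import Relation.Nullary.Decidable using (Dec; yes; no; T?)
open import Data.Bool using (T)
open import Relation.Binary.PropositionalEquality using (_≡_)

Shading : Set
Shading = List (Fin 3 × Fin 3)

allVecs : (m n : ℕ) → List (Vec (Fin n) m)
allVecs zero    n = []ᵥ ∷ []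
allVecs (suc m) n = concatMap (λ v → map (λ x → x ∷ᵥ v) (Data.List.allFin n)) (allVecs m n)
  where import Data.List

distinct : List ℕ → Bool
distinct []       = true
distinct (x ∷ xs) = not (any (λ y → eqᵇ x y) xs) ∧ distinct xs
  where
  eqᵇ : ℕ → ℕ → Bool
  eqᵇ a b = Data.Nat._≡ᵇ_ a b
    where import Data.Nat

word : ∀ {n} → Vec (Fin n) n → List ℕ
word π = map (λ x → suc (toℕ x)) (toList π)

perms : ℕ → List (List ℕ)
perms n = filter (λ w → T? (distinct w)) (map word (allVecs n n))

indexed : List ℕ → List (ℕ × ℕ)
indexed w = zip (map suc (upTo (length w))) w

between : ℕ → ℕ → ℕ → Bool
between lo t hi = (lo <ᵇ t) ∧ (t <ᵇ hi)

boxEmpty : List ℕ → Vec ℕ 4 → Vec ℕ 4 → Fin 3 × Fin 3 → Bool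
boxEmpty w xs ys (a , b) =
  all (λ { (k , v) → not (between (lookup xs (inject₁ a)) k (lookup xs (fsuc a))
                          ∧ between (lookup ys (inject₁ b)) v (lookup ys (fsuc b))) })
      (indexed w)

isOcc : Shading → List ℕ → (ℕ × ℕ) → (ℕ × ℕ) → Bool
isOcc R w (i₁ , v₁) (i₂ , v₂) =
  (i₁ <ᵇ i₂) ∧ (v₁ <ᵇ v₂) ∧
  all (boxEmpty w (0 ∷ᵥ i₁ ∷ᵥ i₂ ∷ᵥ suc (length w) ∷ᵥ []ᵥ)
                  (0 ∷ᵥ v₁ ∷ᵥ v₂ ∷ᵥ suc (length w) ∷ᵥ []ᵥ)) R

occ : Shading → List ℕ → ℕ
occ R w = length (filter (λ p → T? (isOcc R w (Data.Product.proj₁ p) (Data.Product.proj₂ p)))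
                         (concatMap (λ p → map (λ q → (p , q)) (indexed w)) (indexed w)))
  where import Data.Product

s : ℕ → ℕ → Shading → ℕ
s n k R = length (filter (λ w → Data.Nat._≟_ (occ R w) k) (perms n))
  where import Data.Nat

Equidistributed : Shading → Shading → Set
Equidistributed R₁ R₂ = ∀ n k → s n k R₁ ≡ s n k R₂

b : ℕ → ℕ → Fin 3 × Fin 3
b 0 0 = fzero , fzero
b 0 1 = fzero , fsuc fzero
b 0 _ = fzero , fsuc (fsuc fzero)
b 1 0 = fsuc fzero , fzero
b 1 1 = fsuc fzero , fsuc fzero
b 1 _ = fsuc fzero , fsuc (fsuc fzero)
b _ 0 = fsuc (fsuc fzero) , fzero
b _ 1 = fsuc (fsuc fzero) , fsuc fzero
b _ _ = fsuc (fsuc fzero) , fsuc (fsuc fzero)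

sixShadings : List Shading
sixShadings =
    (b 1 2 ∷ b 2 2 ∷ b 0 1 ∷ b 1 1 ∷ [])
  ∷ (b 1 2 ∷ b 0 1 ∷ b 1 1 ∷ b 0 0 ∷ [])
  ∷ (b 2 2 ∷ b 1 1 ∷ b 2 1 ∷ b 1 0 ∷ [])
  ∷ (b 1 1 ∷ b 2 1 ∷ b 0 0 ∷ b 1 0 ∷ [])
  ∷ (b 2 2 ∷ b 0 1 ∷ b 2 1 ∷ b 0 0 ∷ [])
  ∷ (b 1 2 ∷ b 2 2 ∷ b 0 0 ∷ b 1 0 ∷ [])
  ∷ []

{-# OPTIONS --safe #-}
module Submission where

-- Inverse and reverse–complement act on mesh patterns and join the six shadings, numbered
-- as in the statement, into the classes {R₁, R₂, R₃, R₄} and {R₅, R₆}.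
-- For R₂ and R₅ the lower letter x of an occurrence is a left-to-right minimum and its upper letter is the first (R₂),
-- respectively the last (R₅), larger letter to the right of x; this is an occurrence exactly when that letter is smaller
-- than everything to the left of x. Now write the letters of a permutation in decreasing order, always keeping a hole for the
-- next left-to-right minimum: a letter either goes to the right of the hole, or fills it and opens a new hole further right.
-- The first letter right of the hole lies below the previous minimum iff some letter was put at the left end since the hole was
-- opened, the last one iff some letter was put at the right end. Mirroring all insertion places thus exchanges the statistics.

open import Defs
open import Data.Bool using (Bool; true; false; T; not; if_then_else_)
open import Data.Bool.Properties using (T-∧; T-not-≡)
open import Data.Fin as Fin using (Fin; toℕ; fromℕ<; inject₁; opposite)
open import Data.Fin.Patterns using (0F; 1F; 2F)
open import Data.Fin.Properties using (toℕ-injective; toℕ<n; toℕ-fromℕ<)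
open import Data.List hiding (lookup; all; sum; find)
import Data.List.Membership.DecPropositional as DecMembership
open import Data.List.Membership.Propositional using (_∈_; _∉_; find; lose)
open import Data.List.Membership.Propositional.Properties
open import Data.List.Properties using (∷-injective; ++-assoc; ++-identityʳ; ∷ʳ-++; length-++; length-map; map-∘; filter-++)
open import Data.List.Relation.Binary.Permutation.Propositional
  using (_↭_; ↭-refl; ↭-sym; ↭-trans; ↭-prep; ↭-reflexive; ↭⇒↭ₛ)
open import Data.List.Relation.Binary.Permutation.Propositional.Properties
  using (∈-resp-↭; shift; drop-∷; ↭-length; ↭-empty-inv) renaming (map⁺ to ↭-map⁺)
import Data.List.Relation.Binary.Permutation.Setoid.Properties as Permutationₛ
open import Data.List.Relation.Unary.All as All using (All; []; _∷_; all?)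
import Data.List.Relation.Unary.All.Properties as All
open import Data.List.Relation.Unary.AllPairs using ([]; _∷_)
open import Data.List.Relation.Unary.Any using (here; there)
open import Data.List.Relation.Unary.Any.Properties using (any⁺; any⁻)
open import Data.List.Relation.Unary.Unique.Propositional using (Unique)
import Data.List.Relation.Unary.Unique.Propositional.Properties as Unique
open import Data.Nat
open import Data.Nat.ListAction using (sum)
open import Data.Nat.Properties hiding (_≟_)
open import Data.Product using (∃; ∃₂; _×_; _,_; proj₁; proj₂; swap)
import Data.Product.Properties as Product
open import Data.Sum using (_⊎_; inj₁; inj₂)
open import Data.Vec using (Vec; lookup; toList) renaming ([] to []ᵥ; _∷_ to _∷ᵥ_)
open import Function using (_∘_; id; case_of_; Equivalence; _⇔_; mk⇔)
open import Relation.Binary.Definitions using (tri<; tri≈; tri>)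
open import Relation.Binary.PropositionalEquality
open import Relation.Nullary using (Dec; ¬_; yes; no; does; contradiction)
open import Relation.Nullary.Decidable using (_×-dec_; T?; True; toWitness)
open import Relation.Unary using (Decidable)

open Equivalence using (to; from)

private variable
  A B C : Set

-- Lists and counting

∈-++-∷⁻ : ∀ {x y : A} xs {ys} → y ∈ xs ++ x ∷ ys → y ≡ x ⊎ y ∈ xs ++ ys
∈-++-∷⁻ xs y∈ with ∈-++⁻ xs y∈
... | inj₁ y∈xs         = inj₂ (∈-++⁺ˡ y∈xs)
... | inj₂ (here y≡x)   = inj₁ y≡x
... | inj₂ (there y∈ys) = inj₂ (∈-++⁺ʳ xs y∈ys)

length-++-∷ : ∀ (xs : List A) {x ys} → length (xs ++ x ∷ ys) ≡ suc (length (xs ++ ys))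
length-++-∷ xs {x} {ys} = ↭-length (shift x xs ys)

-- The injection is a relation, so an image may depend on the proof that its argument lies in `xs`.
-- The image of the head is cut out of `ys`, and injectivity keeps all other images in what is left.
length-≤-injection : (M : A → B → Set) → (∀ {x x′ y} → M x y → M x′ y → x ≡ x′) →
                     ∀ {xs ys} → Unique xs → (∀ {x} → x ∈ xs → ∃ λ y → y ∈ ys × M x y) →
                     length xs ≤ length ys
length-≤-injection M inj {[]} _ _ = z≤n
length-≤-injection M inj {x ∷ xs} (x∉xs ∷ xs!) f with f (here refl)
... | y , y∈ys , Mxy with ∈-∃++ y∈ys
... | us , vs , refl = ≤-trans (s≤s (length-≤-injection M inj xs! f′)) (≤-reflexive (sym (length-++-∷ us)))
  where
  f′ : ∀ {z} → z ∈ xs → ∃ λ y′ → y′ ∈ us ++ vs × M z y′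
  f′ z∈xs with f (there z∈xs)
  ... | y′ , y′∈ , Mzy′ with ∈-++-∷⁻ us y′∈
  ... | inj₁ refl = contradiction (inj Mxy Mzy′) (All.lookup x∉xs z∈xs)
  ... | inj₂ y′∈′ = y′ , y′∈′ , Mzy′

-- Pigeonhole: the elements of `xs` are cut out of `ys` one by one, and equal lengths leave nothing
-- over.
Unique-⊆⇒↭ : ∀ {xs ys : List A} → Unique xs → (∀ {x} → x ∈ xs → x ∈ ys) →
             length xs ≡ length ys → xs ↭ ys
Unique-⊆⇒↭ {xs = []} {[]} _ _ _ = ↭-refl
Unique-⊆⇒↭ {xs = x ∷ xs} {ys} (x∉xs ∷ xs!) xs⊆ys |xs|≡|ys| with ∈-∃++ (xs⊆ys (here refl))
... | us , vs , refl =
  ↭-trans (↭-prep x (Unique-⊆⇒↭ xs! sub (suc-injective (trans |xs|≡|ys| (length-++-∷ us))))) (↭-sym (shift x us vs))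
  where
  sub : ∀ {z} → z ∈ xs → z ∈ us ++ vs
  sub z∈xs with ∈-++-∷⁻ us (xs⊆ys (there z∈xs))
  ... | inj₁ refl = contradiction refl (All.lookup x∉xs z∈xs)
  ... | inj₂ z∈   = z∈

concatMap-map : ∀ (f : A → B → C) xs {ys} →
                concatMap (λ x → map (f x) ys) xs ≡ cartesianProductWith f xs ys
concatMap-map f []       = refl
concatMap-map f (x ∷ xs) = cong (map (f x) _ ++_) (concatMap-map f xs)

Unique-resp-↭ : ∀ {xs ys : List A} → xs ↭ ys → Unique xs → Unique ys
Unique-resp-↭ {A} = Permutationₛ.Unique-resp-↭ (setoid A) ∘ ↭⇒↭ₛ

Unique-++-∷⇒∉ : ∀ xs {x : A} {ys} → Unique (xs ++ x ∷ ys) → x ∉ xs ++ ys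
Unique-++-∷⇒∉ xs {x} {ys} xs! = Unique.Unique[x∷xs]⇒x∉xs (Unique-resp-↭ (shift x xs ys) xs!)

++-injective : ∀ (xs xs′ : List A) {ys ys′} → length xs ≡ length xs′ →
               xs ++ ys ≡ xs′ ++ ys′ → xs ≡ xs′ × ys ≡ ys′
++-injective []       []         _   eq = refl , eq
++-injective (x ∷ xs) (x′ ∷ xs′) |≡| eq with ∷-injective eq
... | refl , eq′ with ++-injective xs xs′ (suc-injective |≡|) eq′
... | refl , refl = refl , refl

++-∷-injective : ∀ {x : A} xs xs′ {ys ys′} → x ∉ xs → x ∉ xs′ →
                 xs ++ x ∷ ys ≡ xs′ ++ x ∷ ys′ → xs ≡ xs′ × ys ≡ ys′
++-∷-injective []       []         _  _   refl = refl , refl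
++-∷-injective []       (_ ∷ _)    _  x∉′ refl = contradiction (here refl) x∉′
++-∷-injective (_ ∷ _)  []         x∉ _   refl = contradiction (here refl) x∉
++-∷-injective (y ∷ xs) (y′ ∷ xs′) x∉ x∉′ eq with ∷-injective eq
... | refl , eq′ with ++-∷-injective xs xs′ (x∉ ∘ there) (x∉′ ∘ there) eq′
... | refl , refl = refl , refl

length-≡-++ : ∀ m {n} {xs : List A} → length xs ≡ m + n →
              ∃₂ λ ys zs → xs ≡ ys ++ zs × length ys ≡ m × length zs ≡ n
length-≡-++ zero            |xs|≡   = [] , _ , refl , refl , |xs|≡
length-≡-++ (suc m) {xs = x ∷ xs} |xs|≡ with length-≡-++ m {xs = xs} (suc-injective |xs|≡)
... | ys , zs , refl , refl , refl = x ∷ ys , zs , refl , refl , refl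

range : ℕ → ℕ → List ℕ
range c zero    = []
range c (suc k) = c ∷ range (suc c) k

length-range : ∀ c k → length (range c k) ≡ k
length-range c zero    = refl
length-range c (suc k) = cong suc (length-range (suc c) k)

∈-range⁻ : ∀ {x c k} → x ∈ range c k → c ≤ x × x < c + k
∈-range⁻ {c = c} {suc k} (here refl) = ≤-refl , m<m+n c z<s
∈-range⁻ {c = c} {suc k} (there x∈) with ∈-range⁻ x∈
... | c<x , x< = <⇒≤ c<x , ≤-trans x< (≤-reflexive (sym (+-suc c k)))

∈-range⁺ : ∀ {x c k} → c ≤ x → x < c + k → x ∈ range c k
∈-range⁺ {x} {c} {zero} c≤x x< = contradiction (≤-trans x< (≤-reflexive (+-identityʳ c))) (≤⇒≯ c≤x)
∈-range⁺ {x} {c} {suc k} c≤x x< with m≤n⇒m<n∨m≡n c≤x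
... | inj₁ c<x  = there (∈-range⁺ c<x (≤-trans x< (≤-reflexive (+-suc c k))))
... | inj₂ refl = here refl

range! : ∀ c k → Unique (range c k)
range! c zero    = []
range! c (suc k) = All.tabulate (λ x∈ c≡x → <⇒≢ (proj₁ (∈-range⁻ x∈)) c≡x) ∷ range! (suc c) k

-- Permutations

IsPerm : ℕ → List ℕ → Set
IsPerm n w = w ↭ range 1 n

IsPerm-length : ∀ {n w} → IsPerm n w → length w ≡ n
IsPerm-length π = trans (↭-length π) (length-range 1 _)

IsPerm-Unique : ∀ {n w} → IsPerm n w → Unique w
IsPerm-Unique π = Unique-resp-↭ (↭-sym π) (range! 1 _)

IsPerm-∈ : ∀ {n w x} → IsPerm n w → x ∈ w → 1 ≤ x × x ≤ n
IsPerm-∈ π x∈w with ∈-range⁻ (∈-resp-↭ π x∈w)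
... | 1≤x , s≤s x≤n = 1≤x , x≤n

T-not⇔ : ∀ {b} → T (not b) ⇔ (¬ T b)
T-not⇔ {false} = mk⇔ (λ _ ()) _
T-not⇔ {true}  = mk⇔ (λ ()) (λ ¬t → ¬t _)

distinct⇒Unique : ∀ w → T (distinct w) → Unique w
distinct⇒Unique []      _ = []
distinct⇒Unique (x ∷ w) d with to T-∧ d
... | x∉w , w! =
  All.tabulate (λ { y∈w refl → subst T (to T-not-≡ x∉w) (any⁺ _ (lose y∈w (≡⇒≡ᵇ x x refl))) })
  ∷ distinct⇒Unique w w!

Unique⇒distinct : ∀ {w} → Unique w → T (distinct w)
Unique⇒distinct {[]} _ = _
Unique⇒distinct {x ∷ w} (x∉w ∷ w!) = from T-∧ (x-new , Unique⇒distinct w!)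
  where
  x-new = from T-not⇔ (λ x∈w → let y , y∈w , x≡y = find (any⁻ _ w x∈w)
                              in All.lookup x∉w y∈w (≡ᵇ⇒≡ x y x≡y))

allVecs-suc : ∀ m n → allVecs (suc m) n ≡ cartesianProductWith (λ v x → x ∷ᵥ v) (allVecs m n) (allFin n)
allVecs-suc m n = concatMap-map (λ v x → x ∷ᵥ v) (allVecs m n)

∈-allVecs : ∀ {m n} (v : Vec (Fin n) m) → v ∈ allVecs m n
∈-allVecs []ᵥ = here refl
∈-allVecs {suc m} {n} (x ∷ᵥ v) =
  subst (_ ∈_) (sym (allVecs-suc m n)) (∈-cartesianProductWith⁺ _ (∈-allVecs v) (∈-allFin x))

allVecs! : ∀ m n → Unique (allVecs m n)
allVecs! zero    n = [] ∷ []
allVecs! (suc m) n = subst Unique (sym (allVecs-suc m n))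
  (Unique.cartesianProductWith⁺ _ (λ { refl → refl , refl }) (allVecs! m n) (Unique.allFin⁺ n))

letters : ∀ {m n} → Vec (Fin n) m → List ℕ
letters v = map (λ x → suc (toℕ x)) (toList v)

letters-injective : ∀ {m n} {u v : Vec (Fin n) m} → letters u ≡ letters v → u ≡ v
letters-injective {u = []ᵥ} {[]ᵥ} _ = refl
letters-injective {u = x ∷ᵥ u} {y ∷ᵥ v} eq with ∷-injective eq
... | x≡y , u≡v = cong₂ _∷ᵥ_ (toℕ-injective (suc-injective x≡y)) (letters-injective u≡v)

∈-letters : ∀ {m n} (v : Vec (Fin n) m) {x} → x ∈ letters v → x ∈ range 1 n
∈-letters v x∈ with ∈-map⁻ _ x∈
... | i , _ , refl = ∈-range⁺ (s≤s z≤n) (s≤s (toℕ<n i))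

length-letters : ∀ {m n} (v : Vec (Fin n) m) → length (letters v) ≡ m
length-letters []ᵥ      = refl
length-letters (x ∷ᵥ v) = cong suc (length-letters v)

letters-surjective : ∀ {m n} w → length w ≡ m → (∀ {x} → x ∈ w → 1 ≤ x × x ≤ n) →
                     ∃ λ (v : Vec (Fin n) m) → letters v ≡ w
letters-surjective [] refl _ = []ᵥ , refl
letters-surjective (zero ∷ w) refl ok with () ← proj₁ (ok (here refl))
letters-surjective (suc x ∷ w) refl ok with letters-surjective w refl (ok ∘ there)
... | v , eq = fromℕ< x<n ∷ᵥ v , cong₂ _∷_ (cong suc (toℕ-fromℕ< x<n)) eq
  where x<n = proj₂ (ok (here refl))

perms! : ∀ n → Unique (perms n)
perms! n = Unique.filter⁺ _ (Unique.map⁺ letters-injective (allVecs! n n))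

-- By pigeonhole, `n` distinct letters taken from 1, ..., n use each of them once.
∈-perms⁻ : ∀ {n w} → w ∈ perms n → IsPerm n w
∈-perms⁻ {n} {w} w∈ =
  let w∈′ , w!       = ∈-filter⁻ (λ w → T? (distinct w)) {xs = map word (allVecs n n)} w∈
      v , _ , w≡word = ∈-map⁻ word w∈′
  in Unique-⊆⇒↭ (distinct⇒Unique w w!) (∈-letters v ∘ subst (_ ∈_) w≡word)
       (trans (cong length w≡word) (trans (length-letters v) (sym (length-range 1 n))))

∈-perms⁺ : ∀ {n w} → IsPerm n w → w ∈ perms n
∈-perms⁺ {w = w} π with letters-surjective w (IsPerm-length π) (IsPerm-∈ π)
... | v , refl = ∈-filter⁺ (λ w → T? (distinct w)) (∈-map⁺ word (∈-allVecs v)) (Unique⇒distinct (IsPerm-Unique π))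

s-≤ : ∀ R R′ {n} (M : List ℕ → List ℕ → Set) →
      (∀ {w} → IsPerm n w → ∃ λ w′ → IsPerm n w′ × M w w′) →
      (∀ {u v w} → M u w → M v w → u ≡ v) →
      (∀ {w w′} → M w w′ → occ R w ≡ occ R′ w′) →
      ∀ k → s n k R ≤ s n k R′
s-≤ R R′ {n} M total inj occ≡ k = length-≤-injection M inj (Unique.filter⁺ _ (perms! n)) image
  where
  image : ∀ {w} → w ∈ filter (λ w → occ R w ≟ k) (perms n) →
          ∃ λ w′ → w′ ∈ filter (λ w → occ R′ w ≟ k) (perms n) × M w w′
  image w∈ =
    let w∈perms , occ≡k = ∈-filter⁻ (λ w → occ R w ≟ k) {xs = perms n} w∈
        w′ , π′ , Mww′  = total (∈-perms⁻ w∈perms)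
    in w′ , ∈-filter⁺ (λ w → occ R′ w ≟ k) (∈-perms⁺ π′) (trans (sym (occ≡ Mww′)) occ≡k) , Mww′

-- Bijections between permutations are handled as relations. A total, symmetric and injective one is
-- the graph of an involution, and symmetry lets the same relation give both inequalities.
s-≡ : ∀ R R′ {n} (M : List ℕ → List ℕ → Set) →
      (∀ {w} → IsPerm n w → ∃ λ w′ → IsPerm n w′ × M w w′) →
      (∀ {w w′} → M w w′ → M w′ w) →
      (∀ {u v w} → M u w → M v w → u ≡ v) →
      (∀ {w w′} → M w w′ → occ R w ≡ occ R′ w′) →
      ∀ k → s n k R ≡ s n k R′
s-≡ R R′ M total M-sym inj occ≡ k =
  ≤-antisym (s-≤ R R′ M total inj occ≡ k) (s-≤ R′ R M total inj (sym ∘ occ≡ ∘ M-sym) k)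

-- Occurrences as pairs of points

-- The free starting position `c` makes the indexing structurally recursive and lets it split along
-- `++`.
points : ℕ → List ℕ → List (ℕ × ℕ)
points c []      = []
points c (x ∷ w) = (c , x) ∷ points (suc c) w

indexed≡points : ∀ w → indexed w ≡ points 1 w
indexed≡points w = go id w (λ _ → refl)
  where
  -- `upTo` is `applyUpTo id`, and its recursion replaces `f` by `f ∘ suc`; the hypothesis on `f`
  -- keeps track of this shift.
  go : ∀ {c} (f : ℕ → ℕ) w → (∀ i → suc (f i) ≡ c + i) → zip (map suc (applyUpTo f (length w))) w ≡ points c w
  go f []      _  = refl
  go {c} f (x ∷ w) f≡ = cong₂ _∷_ (cong (_, x) (trans (f≡ 0) (+-identityʳ c)))
                          (go (f ∘ suc) w (λ i → trans (f≡ (suc i)) (+-suc c i)))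

∈-points⁻ : ∀ {c w k v} → (k , v) ∈ points c w → (c ≤ k × k < c + length w) × v ∈ w
∈-points⁻ {c} {x ∷ w} (here refl) = (≤-refl , m<m+n c z<s) , here refl
∈-points⁻ {c} {x ∷ w} (there p∈) with ∈-points⁻ p∈
... | (c<k , k<) , v∈ = (<⇒≤ c<k , ≤-trans k< (≤-reflexive (sym (+-suc c (length w))))) , there v∈

∈-points⁺ : ∀ {c w v} → v ∈ w → ∃ λ k → (k , v) ∈ points c w
∈-points⁺ {c} (here refl) = c , here refl
∈-points⁺ (there v∈)      = let k , p∈ = ∈-points⁺ v∈ in k , there p∈

points-++ : ∀ c u {w} → points c (u ++ w) ≡ points c u ++ points (c + length u) w
points-++ c []      {w} = cong (λ d → points d w) (sym (+-identityʳ c))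
points-++ c (x ∷ u) {w} = cong ((c , x) ∷_) (trans (points-++ (suc c) u)
  (cong (λ d → points (suc c) u ++ points d w) (sym (+-suc c (length u)))))

map-proj₁-points : ∀ c w → map proj₁ (points c w) ≡ range c (length w)
map-proj₁-points c []      = refl
map-proj₁-points c (x ∷ w) = cong (c ∷_) (map-proj₁-points (suc c) w)

map-proj₂-points : ∀ c w → map proj₂ (points c w) ≡ w
map-proj₂-points c []      = refl
map-proj₂-points c (x ∷ w) = cong (x ∷_) (map-proj₂-points (suc c) w)

points! : ∀ c w → Unique (points c w)
points! c w = Unique.map⁻ (subst Unique (sym (map-proj₁-points c w)) (range! c (length w)))

-- Positions in the tails start at `suc c`, so the point at position `c` can only match the head;
-- one inclusion therefore suffices.
points-injective : ∀ {c u w} → length u ≡ length w →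
                   (∀ {p} → p ∈ points c u → p ∈ points c w) → u ≡ w
points-injective {u = []} {[]} _ _ = refl
points-injective {c} {x ∷ u} {y ∷ w} |≡| u⊆w = cong₂ _∷_ x≡y (points-injective (suc-injective |≡|) tail⊆)
  where
  x≡y : x ≡ y
  x≡y with u⊆w (here refl)
  ... | here refl = refl
  ... | there p∈  = contradiction (proj₁ (proj₁ (∈-points⁻ p∈))) 1+n≰n
  tail⊆ : ∀ {p} → p ∈ points (suc c) u → p ∈ points (suc c) w
  tail⊆ p∈u with u⊆w (there p∈u)
  ... | here refl = contradiction (proj₁ (proj₁ (∈-points⁻ p∈u))) 1+n≰n
  ... | there p∈w = p∈w

-- A list of points that uses every position once is the graph of a word, read off by extracting the
-- point at each position in turn.
points-surjective : ∀ {c} k ps → map proj₁ ps ↭ range c k → ∃ λ w → points c w ↭ ps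
points-surjective zero [] _ = [] , ↭-refl
points-surjective zero (_ ∷ _) ps↭ with () ← ↭-empty-inv ps↭
points-surjective {c} (suc k) ps ps↭ with ∈-map⁻ proj₁ (∈-resp-↭ (↭-sym ps↭) (here refl))
... | (_ , y) , p∈ , refl with ∈-∃++ p∈
... | qs , rs , refl with points-surjective k (qs ++ rs) (drop-∷ (↭-trans (↭-sym (↭-map⁺ proj₁ (shift (c , y) qs rs))) ps↭))
... | w , w↭ = y ∷ w , ↭-trans (↭-prep (c , y) w↭) (↭-sym (shift (c , y) qs rs))

cuts : ℕ → ℕ → ℕ → Vec ℕ 4
cuts n x y = 0 ∷ᵥ x ∷ᵥ y ∷ᵥ suc n ∷ᵥ []ᵥ

-- The open column or row number `a` of the mesh; one definition serves both axes.
Strip : Vec ℕ 4 → Fin 3 → ℕ → Set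
Strip xs a k = lookup xs (inject₁ a) < k × k < lookup xs (Fin.suc a)

-- Positions and values enter symmetrically, and the word enters only through its points, so
-- symmetries of the square act directly on this form.
record Occ (n : ℕ) (R : Shading) (ps : List (ℕ × ℕ)) (p q : ℕ × ℕ) : Set where
  constructor mkOcc
  field
    pos<  : proj₁ p < proj₁ q
    val<  : proj₂ p < proj₂ q
    empty : ∀ {a b} → (a , b) ∈ R → ∀ {k v} → (k , v) ∈ ps →
            Strip (cuts n (proj₁ p) (proj₁ q)) a k → ¬ Strip (cuts n (proj₂ p) (proj₂ q)) b v
open Occ public

between⇔ : ∀ {lo t hi} → T (between lo t hi) ⇔ (lo < t × t < hi)
between⇔ = mk⇔ (λ b → let l , h = to T-∧ b in <ᵇ⇒< _ _ l , <ᵇ⇒< _ _ h)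
               (λ (l , h) → from T-∧ (<⇒<ᵇ l , <⇒<ᵇ h))

boxEmpty⇔ : ∀ w xs ys a b → T (boxEmpty w xs ys (a , b)) ⇔
            (∀ {k v} → (k , v) ∈ points 1 w → Strip xs a k → ¬ Strip ys b v)
boxEmpty⇔ w xs ys a b rewrite sym (indexed≡points w) = mk⇔ f g
  where
  Empty : Set
  Empty = ∀ {k v} → (k , v) ∈ indexed w → Strip xs a k → ¬ Strip ys b v
  f : T (boxEmpty w xs ys (a , b)) → Empty
  f t kv∈ k∈ v∈ = to T-not⇔ (All.lookup (All.all⁺ _ (indexed w) t) kv∈) (from T-∧ (from between⇔ k∈ , from between⇔ v∈))
  g : Empty → T (boxEmpty w xs ys (a , b))
  g h = All.all⁻ _ (All.tabulate {xs = indexed w} λ {(k , v)} kv∈ → from T-not⇔ λ t →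
    let tk , tv = to T-∧ t in h kv∈ (to between⇔ tk) (to between⇔ tv))

isOcc⇔Occ : ∀ {n w} → IsPerm n w → ∀ R p q → T (isOcc R w p q) ⇔ Occ n R (points 1 w) p q
isOcc⇔Occ {w = w} π R p q with IsPerm-length π
... | refl = mk⇔ f g
  where
  xs = cuts (length w) (proj₁ p) (proj₁ q)
  ys = cuts (length w) (proj₂ p) (proj₂ q)
  f : T (isOcc R w p q) → Occ (length w) R (points 1 w) p q
  f t = let i , t′ = to T-∧ t
            v , r  = to T-∧ t′
        in mkOcc (<ᵇ⇒< _ _ i) (<ᵇ⇒< _ _ v) λ {a} {b} ab∈R →
             to (boxEmpty⇔ w xs ys a b) (All.lookup (All.all⁺ _ R r) ab∈R)
  g : Occ (length w) R (points 1 w) p q → T (isOcc R w p q)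
  g o = from T-∧ (<⇒<ᵇ (pos< o) , from T-∧ (<⇒<ᵇ (val< o) ,
          All.all⁻ (boxEmpty w xs ys) (All.tabulate λ {(a , b)} ab∈R → from (boxEmpty⇔ w xs ys a b) (empty o ab∈R))))

occurrences : Shading → List ℕ → List ((ℕ × ℕ) × (ℕ × ℕ))
occurrences R w = filter (λ (p , q) → T? (isOcc R w p q)) (cartesianProduct (points 1 w) (points 1 w))

occ≡ : ∀ R w → occ R w ≡ length (occurrences R w)
occ≡ R w = cong (length ∘ filter (λ (p , q) → T? (isOcc R w p q)))
  (trans (concatMap-map _,_ (indexed w)) (cong (λ ps → cartesianProduct ps ps) (indexed≡points w)))

∈-occurrences : ∀ {n w} → IsPerm n w → ∀ R {p q} → (p , q) ∈ occurrences R w ⇔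
                (p ∈ points 1 w × q ∈ points 1 w × Occ n R (points 1 w) p q)
∈-occurrences {w = w} π R {p} {q} = mk⇔
  (λ pq∈ → let pq∈′ , t = ∈-filter⁻ _ {xs = cartesianProduct (points 1 w) (points 1 w)} pq∈
               p∈ , q∈  = ∈-cartesianProduct⁻ (points 1 w) (points 1 w) pq∈′
           in p∈ , q∈ , to (isOcc⇔Occ π R p q) t)
  (λ (p∈ , q∈ , o) → ∈-filter⁺ _ (∈-cartesianProduct⁺ p∈ q∈) (from (isOcc⇔Occ π R p q) o))

occurrences! : ∀ R w → Unique (occurrences R w)
occurrences! R w = Unique.filter⁺ _ (Unique.cartesianProduct⁺ (points! 1 w) (points! 1 w))

-- Inverse and reverse–complement

InSquare : ℕ → ℕ × ℕ → Set
InSquare n (k , v) = (1 ≤ k × k ≤ n) × (1 ≤ v × v ≤ n)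

points⇒InSquare : ∀ {n w p} → IsPerm n w → p ∈ points 1 w → InSquare n p
points⇒InSquare π p∈ with ∈-points⁻ p∈
... | (1≤k , s≤s k≤) , v∈ = (1≤k , ≤-trans k≤ (≤-reflexive (IsPerm-length π))) , IsPerm-∈ π v∈

-- The points of `w′` are the `σ`-images of those of `w`. Since `σ` will be an involution, the way
-- back is again `σ`, which makes the relation symmetric.
record Related (σ : ℕ × ℕ → ℕ × ℕ) (n : ℕ) (w w′ : List ℕ) : Set where
  field
    perm     : IsPerm n w
    perm′    : IsPerm n w′
    forward  : ∀ {p} → p ∈ points 1 w → σ p ∈ points 1 w′
    backward : ∀ {p} → p ∈ points 1 w′ → σ p ∈ points 1 w
open Related

Related-sym : ∀ {σ n w w′} → Related σ n w w′ → Related σ n w′ w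
Related-sym r = record { perm = perm′ r ; perm′ = perm r ; forward = backward r ; backward = forward r }

Involutiveₙ : ℕ → (ℕ × ℕ → ℕ × ℕ) → Set
Involutiveₙ n σ = ∀ {p} → InSquare n p → σ (σ p) ≡ p

module _ (σ : ℕ × ℕ → ℕ × ℕ) {n} (σ-involutive : Involutiveₙ n σ) where

  -- A point of `u` goes to `w` and from there back into `v`, where it arrives as `σ (σ p)`, that
  -- is, as itself.
  Related-injective : ∀ {u v w} → Related σ n u w → Related σ n v w → u ≡ v
  Related-injective ru rv = points-injective (trans (IsPerm-length (perm ru)) (sym (IsPerm-length (perm rv))))
    λ p∈u → subst (_∈ _) (σ-involutive (points⇒InSquare (perm ru) p∈u)) (backward rv (forward ru p∈u))

  -- The condition on first coordinates makes the image the graph of a word; the one on second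
  -- coordinates makes that word a permutation.
  Related-total : ∀ {w} → IsPerm n w →
                  map proj₁ (map σ (points 1 w)) ↭ range 1 n →
                  map proj₂ (map σ (points 1 w)) ↭ range 1 n →
                  ∃ λ w′ → IsPerm n w′ × Related σ n w w′
  Related-total {w} π π₁ π₂ with points-surjective n (map σ (points 1 w)) π₁
  ... | w′ , w′↭ = w′ , π′ , record
    { perm     = π
    ; perm′    = π′
    ; forward  = λ p∈ → ∈-resp-↭ (↭-sym w′↭) (∈-map⁺ σ p∈)
    ; backward = λ p∈ → let q , q∈ , p≡σq = ∈-map⁻ σ (∈-resp-↭ w′↭ p∈)
                        in subst (_∈ _) (trans (sym (σ-involutive (points⇒InSquare π q∈))) (cong σ (sym p≡σq))) q∈
    }
    where π′ = ↭-trans (↭-reflexive (sym (map-proj₂-points 1 w′))) (↭-trans (↭-map⁺ proj₂ w′↭) π₂)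

-- The map r on pairs is the identity or swap: reverse–complement exchanges the two points of an occurrence.
module _ (σ : ℕ × ℕ → ℕ × ℕ) (r : (ℕ × ℕ) × (ℕ × ℕ) → (ℕ × ℕ) × (ℕ × ℕ)) where

  Transfers : ℕ → Shading → Shading → Set
  Transfers n R R′ = ∀ {w w′} → Related σ n w w′ → ∀ {p q} → (p , q) ∈ occurrences R w →
                     r (σ p , σ q) ∈ occurrences R′ w′

  -- `σ` is known to be injective only inside the square, so the matching `M` records that its
  -- source is an occurrence, whose points lie there.
  occ-≤ : ∀ {n w w′} R R′ → (∀ {z z′} → r z ≡ r z′ → z ≡ z′) → Involutiveₙ n σ →
          Transfers n R R′ → Related σ n w w′ → occ R w ≤ occ R′ w′
  occ-≤ {n} {w} {w′} R R′ r-inj σ-inv transfers rel = subst₂ _≤_ (sym (occ≡ R w)) (sym (occ≡ R′ w′))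
    (length-≤-injection M inj (occurrences! R w) λ z∈ → _ , transfers rel z∈ , z∈ , refl)
    where
    M : (ℕ × ℕ) × (ℕ × ℕ) → (ℕ × ℕ) × (ℕ × ℕ) → Set
    M (p , q) z = (p , q) ∈ occurrences R w × z ≡ r (σ p , σ q)
    σ-inj : ∀ {p p′} → p ∈ points 1 w → p′ ∈ points 1 w → σ p ≡ σ p′ → p ≡ p′
    σ-inj p∈ p′∈ eq = trans (sym (σ-inv (points⇒InSquare (perm rel) p∈)))
                        (trans (cong σ eq) (σ-inv (points⇒InSquare (perm rel) p′∈)))
    inj : ∀ {z z′ y} → M z y → M z′ y → z ≡ z′
    inj (z∈ , y≡) (z′∈ , y≡′) =
      let p∈ , q∈ , _   = to (∈-occurrences (perm rel) R) z∈
          p′∈ , q′∈ , _ = to (∈-occurrences (perm rel) R) z′∈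
          eq            = r-inj (trans (sym y≡) y≡′)
      in cong₂ _,_ (σ-inj p∈ p′∈ (cong proj₁ eq)) (σ-inj q∈ q′∈ (cong proj₂ eq))

  s-≡-symmetry : ∀ {n} R R′ → (∀ {z z′} → r z ≡ r z′ → z ≡ z′) → Involutiveₙ n σ →
                 (∀ {w} → IsPerm n w → map proj₁ (map σ (points 1 w)) ↭ range 1 n ×
                                       map proj₂ (map σ (points 1 w)) ↭ range 1 n) →
                 Transfers n R R′ → Transfers n R′ R → ∀ k → s n k R ≡ s n k R′
  s-≡-symmetry {n} R R′ r-inj σ-inv images t t′ = s-≡ R R′ (Related σ n)
    (λ π → Related-total σ σ-inv π (proj₁ (images π)) (proj₂ (images π)))
    Related-sym
    (Related-injective σ σ-inv)
    λ rel → ≤-antisym (occ-≤ R R′ r-inj σ-inv t rel) (occ-≤ R′ R r-inj σ-inv t′ (Related-sym rel))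

inverse-transfers : ∀ {n R R′} → (∀ {a b} → (a , b) ∈ R′ → (b , a) ∈ R) → Transfers swap id n R R′
inverse-transfers {R = R} {R′} R′⊆ {w} {w′} rel pq∈ =
  let p∈ , q∈ , o = to (∈-occurrences (perm rel) R) pq∈
  in from (∈-occurrences (perm′ rel) R′) (forward rel p∈ , forward rel q∈ , mkOcc (val< o) (pos< o)
       λ ab∈ kv∈ k∈ v∈ → empty o (R′⊆ ab∈) (backward rel kv∈) v∈ k∈)

equidistributed-inverse : ∀ R R′ → (∀ {a b} → (a , b) ∈ R′ → (b , a) ∈ R) → (∀ {a b} → (a , b) ∈ R → (b , a) ∈ R′) →
                          Equidistributed R R′
equidistributed-inverse R R′ R′⊆ R⊆ n = s-≡-symmetry swap id R R′ id (λ _ → refl) images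
  (inverse-transfers R′⊆) (inverse-transfers R⊆)
  where
  images : ∀ {w} → IsPerm n w → map proj₁ (map swap (points 1 w)) ↭ range 1 n ×
                                map proj₂ (map swap (points 1 w)) ↭ range 1 n
  images {w} π = ↭-trans (↭-reflexive (trans (sym (map-∘ (points 1 w))) (map-proj₂-points 1 w))) π
               , ↭-reflexive (trans (sym (map-∘ (points 1 w)))
                   (trans (map-proj₁-points 1 w) (cong (range 1) (IsPerm-length π))))

reverse-complement : ℕ → ℕ × ℕ → ℕ × ℕ
reverse-complement n (k , v) = suc n ∸ k , suc n ∸ v

map-∸-range : ∀ n → map (suc n ∸_) (range 1 n) ↭ range 1 n
map-∸-range n = Unique-⊆⇒↭ (map-! (range! 1 n) λ x∈ → ≤-trans (≤-pred (proj₂ (∈-range⁻ x∈))) (n≤1+n n)) ⊆range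
  (length-map _ (range 1 n))
  where
  map-! : ∀ {N xs} → Unique xs → (∀ {x} → x ∈ xs → x ≤ N) → Unique (map (N ∸_) xs)
  map-! [] _ = []
  map-! (x∉ ∷ xs!) ≤N = All.tabulate (λ y∈ eq → let z , z∈ , y≡ = ∈-map⁻ _ y∈ in
      All.lookup x∉ z∈ (∸-cancelˡ-≡ (≤N (here refl)) (≤N (there z∈)) (trans eq y≡)))
    ∷ map-! xs! (≤N ∘ there)
  ⊆range : ∀ {x} → x ∈ map (suc n ∸_) (range 1 n) → x ∈ range 1 n
  ⊆range x∈ with ∈-map⁻ _ x∈
  ... | y , y∈ , refl with ∈-range⁻ {y} {1} {n} y∈
  -- With `y` exposed as `suc y′`, the difference `suc n ∸ y` reduces to `n ∸ y′`, which is at most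
  -- `n`.
  ... | s≤s {n = y′} _ , y< = ∈-range⁺ (m<n⇒0<n∸m y<) (s≤s (m∸n≤m n y′))

-- Subtraction from `suc n` reverses order and exchanges the outer cuts 0 and `suc n`, so the strips
-- are met in the opposite order.
Strip-∸ : ∀ {n x y} a {k} → x ≤ suc n → y ≤ suc n → k ≤ suc n →
          Strip (cuts n (suc n ∸ y) (suc n ∸ x)) a k → Strip (cuts n x y) (opposite a) (suc n ∸ k)
Strip-∸ {n} {x} {y} a {k} x≤ y≤ k≤ = go a
  where
  N = suc n
  below : ∀ {z} → z ≤ N → k < N ∸ z → z < N ∸ k
  below {z} z≤ k< = subst (_< N ∸ k) (m∸[m∸n]≡n z≤) (∸-monoʳ-< k< (m∸n≤m N z))
  above : ∀ {z} → z ≤ N → N ∸ z < k → N ∸ k < z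
  above {z} z≤ <k = subst (N ∸ k <_) (m∸[m∸n]≡n z≤) (∸-monoʳ-< <k k≤)
  go : ∀ a → Strip (cuts n (N ∸ y) (N ∸ x)) a k → Strip (cuts n x y) (opposite a) (N ∸ k)
  go 0F (0<k , k<) = below y≤ k< , ∸-monoʳ-< 0<k k≤
  go 1F (<k , k<)  = below x≤ k< , above y≤ <k
  go 2F (<k , k<)  = m<n⇒0<n∸m k< , above x≤ <k

reverse-complement-transfers : ∀ {n R R′} → (∀ {a b} → (a , b) ∈ R′ → (opposite a , opposite b) ∈ R) →
                               Transfers (reverse-complement n) swap n R R′
reverse-complement-transfers {n} {R} {R′} R′⊆ {w} {w′} rel {i , x} {j , y} pq∈ =
  let p∈ , q∈ , o = to (∈-occurrences (perm rel) R) pq∈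
      i≤ , x≤ = bounds (points⇒InSquare (perm rel) p∈)
      j≤ , y≤ = bounds (points⇒InSquare (perm rel) q∈)
  in from (∈-occurrences (perm′ rel) R′) (forward rel q∈ , forward rel p∈ , mkOcc (∸-monoʳ-< (pos< o) j≤) (∸-monoʳ-< (val< o) y≤)
       λ {a} {b} ab∈ kv∈ k∈ v∈ → let k≤ , v≤ = bounds (points⇒InSquare (perm′ rel) kv∈)
         in empty o (R′⊆ ab∈) (backward rel kv∈) (Strip-∸ a i≤ j≤ k≤ k∈) (Strip-∸ b x≤ y≤ v≤ v∈))
  where
  bounds : ∀ {k v} → InSquare n (k , v) → k ≤ suc n × v ≤ suc n
  bounds ((_ , k≤) , (_ , v≤)) = m≤n⇒m≤1+n k≤ , m≤n⇒m≤1+n v≤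

equidistributed-reverse-complement :
  ∀ R R′ → (∀ {a b} → (a , b) ∈ R′ → (opposite a , opposite b) ∈ R) →
           (∀ {a b} → (a , b) ∈ R → (opposite a , opposite b) ∈ R′) → Equidistributed R R′
equidistributed-reverse-complement R R′ R′⊆ R⊆ n =
  s-≡-symmetry σ swap R R′ (cong swap) involutive images (reverse-complement-transfers R′⊆) (reverse-complement-transfers R⊆)
  where
  σ = reverse-complement n
  involutive : Involutiveₙ n σ
  involutive ((_ , k≤) , (_ , v≤)) = cong₂ _,_ (m∸[m∸n]≡n (m≤n⇒m≤1+n k≤)) (m∸[m∸n]≡n (m≤n⇒m≤1+n v≤))
  images : ∀ {w} → IsPerm n w → map proj₁ (map σ (points 1 w)) ↭ range 1 n ×
                                map proj₂ (map σ (points 1 w)) ↭ range 1 n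
  images {w} π =
      ↭-trans (↭-reflexive (trans (sym (map-∘ ps)) (trans (map-∘ ps)
        (cong (map (suc n ∸_)) (trans (map-proj₁-points 1 w) (cong (range 1) (IsPerm-length π))))))) (map-∸-range n)
    , ↭-trans (↭-reflexive (trans (sym (map-∘ ps)) (trans (map-∘ ps)
        (cong (map (suc n ∸_)) (map-proj₂-points 1 w))))) (↭-trans (↭-map⁺ (suc n ∸_) π) (map-∸-range n))
    where ps = points 1 w

-- Mirrored insertion

-- Mirror k c L V L′ V′ relates the words L ▢ V and L′ ▢ V′ on the letters c, …, c + k − 1, where ▢ is the hole.
data Mirror : ℕ → ℕ → (L V L′ V′ : List ℕ) → Set where
  start  : ∀ {c} → Mirror 0 c [] [] [] []
  insert : ∀ {k c L L′} X Y X′ Y′ → length X ≡ length Y′ → length Y ≡ length X′ →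
           Mirror k (suc c) L (X ++ Y) L′ (X′ ++ Y′) → Mirror (suc k) c L (X ++ c ∷ Y) L′ (X′ ++ c ∷ Y′)
  fill   : ∀ {k c} L L′ X Y X′ Y′ → length X ≡ length X′ → length Y ≡ length Y′ →
           Mirror k (suc c) L (X ++ Y) L′ (X′ ++ Y′) → Mirror (suc k) c (L ++ c ∷ X) Y (L′ ++ c ∷ X′) Y′

Mirror-sym : ∀ {k c L V L′ V′} → Mirror k c L V L′ V′ → Mirror k c L′ V′ L V
Mirror-sym start                            = start
Mirror-sym (insert X Y X′ Y′ |X| |Y| m)     = insert X′ Y′ X Y (sym |Y|) (sym |X|) (Mirror-sym m)
Mirror-sym (fill L L′ X Y X′ Y′ |X| |Y| m)  = fill L′ L X′ Y′ X Y (sym |X|) (sym |Y|) (Mirror-sym m)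

shift-insert : ∀ {c : ℕ} L X {Y} → L ++ X ++ c ∷ Y ↭ c ∷ L ++ X ++ Y
shift-insert {c} L X {Y} = ↭-trans (↭-reflexive (sym (++-assoc L X (c ∷ Y))))
  (↭-trans (shift c (L ++ X) Y) (↭-prep c (↭-reflexive (++-assoc L X Y))))

shift-fill : ∀ {c : ℕ} L X {Y} → (L ++ c ∷ X) ++ Y ↭ c ∷ L ++ X ++ Y
shift-fill {c} L X {Y} = ↭-trans (↭-reflexive (++-assoc L (c ∷ X) Y)) (shift c L (X ++ Y))

Mirror-↭ : ∀ {k c L V L′ V′} → Mirror k c L V L′ V′ → L ++ V ↭ range c k
Mirror-↭ start = ↭-refl
Mirror-↭ (insert {L = L} X Y X′ Y′ _ _ m) = ↭-trans (shift-insert L X) (↭-prep _ (Mirror-↭ m))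
Mirror-↭ (fill L L′ X Y X′ Y′ _ _ m)      = ↭-trans (shift-fill L X) (↭-prep _ (Mirror-↭ m))

Mirror-> : ∀ {k c L V L′ V′} → Mirror k (suc c) L V L′ V′ → All (c <_) (L ++ V)
Mirror-> m = All.tabulate (proj₁ ∘ ∈-range⁻ ∘ ∈-resp-↭ (Mirror-↭ m))

-- The smallest letter `c` was added last: it was inserted if it is right of the hole, and it filled
-- the previous hole if it is left of it. The invariant that `V` and `V′` have equal length
-- guarantees the required cut of the mirrored word, at `length Y` for an insertion and at
-- `length X` for a fill.
Mirror-total : ∀ k c L V → L ++ V ↭ range c k → ∃₂ λ L′ V′ → Mirror k c L V L′ V′ × length V ≡ length V′
Mirror-total zero c [] [] _ = [] , [] , start , refl
Mirror-total zero c [] (_ ∷ _) π with () ← ↭-empty-inv π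
Mirror-total zero c (_ ∷ _) V π with () ← ↭-empty-inv π
Mirror-total (suc k) c L V π with ∈-++⁻ L (∈-resp-↭ (↭-sym π) (here refl))
... | inj₂ c∈V with ∈-∃++ c∈V
... | X , Y , refl with Mirror-total k (suc c) L (X ++ Y) (drop-∷ (↭-trans (↭-sym (shift-insert L X)) π))
... | L′ , V′ , m , |V| with length-≡-++ (length Y) {length X} {V′} (trans (sym |V|) (trans (length-++ X) (+-comm (length X) (length Y))))
... | X′ , Y′ , refl , |X′| , |Y′| = L′ , X′ ++ c ∷ Y′ , insert X Y X′ Y′ (sym |Y′|) (sym |X′|) m
  , trans (length-++-∷ X) (trans (cong suc |V|) (sym (length-++-∷ X′)))
Mirror-total (suc k) c L V π | inj₁ c∈L with ∈-∃++ c∈L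
... | L₀ , X , refl with Mirror-total k (suc c) L₀ (X ++ V) (drop-∷ (↭-trans (↭-sym (shift-fill L₀ X)) π))
... | L′ , V′ , m , |V| with length-≡-++ (length X) {length V} {V′} (trans (sym |V|) (length-++ X))
... | X′ , Y′ , refl , |X′| , |Y′| = L′ ++ c ∷ X′ , Y′ , fill L₀ L′ X V X′ Y′ (sym |X′|) (sym |Y′|) m , sym |Y′|

All->⇒∉ : ∀ {c xs} → All (c <_) xs → c ∉ xs
All->⇒∉ c< c∈ = <-irrefl refl (All.lookup c< c∈)

-- The last step can be undone from `L₁` and `V₁` alone: the side of the hole on which `c` lies
-- tells which step it was, `c` occurs only once, and the length conditions carry its place over to
-- the other word.
Mirror-injective : ∀ {k c L V M W L₁ V₁ L₂ V₂} → Mirror k c L V L₁ V₁ → Mirror k c M W L₂ V₂ →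
                   L₁ ≡ L₂ → V₁ ≡ V₂ → L ≡ M × V ≡ W
Mirror-injective start start _ _ = refl , refl
Mirror-injective (insert {L′ = L′} X Y X′ Y′ |X| |Y| m) (insert {L′ = M′} Z W Z′ W′ |Z| |W| m₁) L≡ V≡
  with ++-∷-injective X′ Z′ (c∉ m) (c∉ m₁) V≡
  where
  c∉ : ∀ {k c L V L′ X′ Y′} → Mirror k (suc c) L V L′ (X′ ++ Y′) → c ∉ X′
  c∉ {L′ = L′} {X′} m = All->⇒∉ (All.++⁻ˡ X′ (All.++⁻ʳ L′ (Mirror-> (Mirror-sym m))))
... | refl , refl with Mirror-injective m m₁ L≡ refl
... | refl , XY≡ with ++-injective X Z (trans |X| (sym |Z|)) XY≡
... | refl , refl = refl , refl
Mirror-injective (fill L L′ X Y X′ Y′ |X| |Y| m) (fill M M′ Z W Z′ W′ |Z| |W| m₁) L≡ refl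
  with ++-∷-injective L′ M′ (c∉ m) (c∉ m₁) L≡
  where
  c∉ : ∀ {k c L V L′ V′} → Mirror k (suc c) L V L′ V′ → c ∉ L′
  c∉ {L′ = L′} m = All->⇒∉ (All.++⁻ˡ L′ (Mirror-> (Mirror-sym m)))
... | refl , refl with Mirror-injective m m₁ refl refl
... | refl , XY≡ with ++-injective X Z (trans |X| (sym |Z|)) XY≡
... | refl , refl = refl , refl
Mirror-injective (insert {L′ = L′} X Y X′ Y′ _ _ m) (fill M M′ Z W Z′ W′ _ _ m₁) refl V≡ =
  contradiction (∈-insert M′) (All->⇒∉ (All.++⁻ˡ L′ (Mirror-> (Mirror-sym m))))
Mirror-injective (fill L L′ X Y X′ Y′ _ _ m) (insert {L′ = M′} Z W Z′ W′ _ _ m₁) refl V≡ =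
  contradiction (∈-insert L′) (All->⇒∉ (All.++⁻ˡ M′ (Mirror-> (Mirror-sym m₁))))

-- Statistics of a single letter

case? : {A : Set} → Dec A → ℕ → ℕ → ℕ
case? d m n = if does d then m else n

case?-yes : ∀ {A : Set} (d : Dec A) {m n} → A → case? d m n ≡ m
case?-yes (yes _) _ = refl
case?-yes (no ¬a) a = contradiction a ¬a

case?-no : ∀ {A : Set} (d : Dec A) {m n} → ¬ A → case? d m n ≡ n
case?-no (yes a) ¬a = contradiction a ¬a
case?-no (no _)  _  = refl

case?-⇔ : ∀ {A B : Set} (d : Dec A) (e : Dec B) {m n} → A ⇔ B → case? d m n ≡ case? e m n
case?-⇔ (yes a) e A⇔B = sym (case?-yes e (to A⇔B a))
case?-⇔ (no ¬a) e A⇔B = sym (case?-no e (¬a ∘ from A⇔B))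

-- The number (0 or 1) of occurrences of R₂, respectively R₅, with lower letter x in the word P x W.
firstAbove : List ℕ → ℕ → List ℕ → ℕ
firstAbove P x []      = 0
firstAbove P x (y ∷ W) = case? (y <? x) (firstAbove P x W) (case? (all? (y <?_) P) 1 0)

lastAbove : List ℕ → ℕ → List ℕ → ℕ
lastAbove P x []      = 0
lastAbove P x (y ∷ W) = case? (all? (_<? x) W) (case? ((x <? y) ×-dec all? (y <?_) P) 1 0) (lastAbove P x W)

-- lower: below all of V, the letter c acts like the hole, represented by the letter 0.
record Statistic (e : List ℕ → ℕ → List ℕ → ℕ) : Set where
  field
    drop-small : ∀ {c y} P X {Y} → c < y → e P y (X ++ c ∷ Y) ≡ e P y (X ++ Y)
    blocked    : ∀ {c P} x {W} → c ∈ P → All (c <_) W → e P x W ≡ 0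
    lower      : ∀ {c} P {V} → All (c <_) V → e P c V ≡ e P 0 V

∉-below : ∀ {c y P} → c ∈ P → c < y → ¬ All (y <_) P
∉-below c∈P c<y y<P = <-asym c<y (All.lookup y<P c∈P)

-- The scan skips letters below `y`; a letter of `P` below all of `W` fails every test against the
-- prefix; and for letters above `c`, comparison with `c` comes out as comparison with 0.
firstAbove-statistic : Statistic firstAbove
firstAbove-statistic = record { drop-small = drop-small ; blocked = blocked ; lower = lower }
  where
  drop-small : ∀ {c y} P X {Y} → c < y → firstAbove P y (X ++ c ∷ Y) ≡ firstAbove P y (X ++ Y)
  drop-small {c} {y} P []      c<y = case?-yes (c <? y) c<y
  drop-small {c} {y} P (x ∷ X) c<y = cong (λ m → case? (x <? y) m (case? (all? (x <?_) P) 1 0)) (drop-small P X c<y)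
  blocked : ∀ {c P} x {W} → c ∈ P → All (c <_) W → firstAbove P x W ≡ 0
  blocked x {[]} _ _ = refl
  blocked {P = P} x {y ∷ W} c∈P (c<y ∷ c<W) with y <? x
  ... | yes y<x = trans (case?-yes (y <? x) y<x) (blocked x c∈P c<W)
  ... | no  y≮x = trans (case?-no (y <? x) y≮x) (case?-no (all? (y <?_) P) (∉-below c∈P c<y))
  lower : ∀ {c} P {V} → All (c <_) V → firstAbove P c V ≡ firstAbove P 0 V
  lower P [] = refl
  lower {c} P {y ∷ V} (c<y ∷ _) = case?-no (y <? c) (<-asym c<y)

lastAbove-0 : ∀ P x {W} → All (_< x) W → lastAbove P x W ≡ 0
lastAbove-0 P x [] = refl
lastAbove-0 P x {y ∷ W} (y<x ∷ W<x) = trans (case?-yes (all? (_<? x) W) W<x)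
  (case?-no ((x <? y) ×-dec all? (y <?_) P) (<-asym y<x ∘ proj₁))

lastAbove-statistic : Statistic lastAbove
lastAbove-statistic = record { drop-small = drop-small ; blocked = blocked ; lower = lower }
  where
  drop-small : ∀ {c y} P X {Y} → c < y → lastAbove P y (X ++ c ∷ Y) ≡ lastAbove P y (X ++ Y)
  drop-small {c} {y} P [] {Y} c<y with all? (_<? y) Y
  -- Neither `c` nor any letter after it exceeds `y`, so both sides are 0.
  ... | yes Y<y = trans (case?-no ((y <? c) ×-dec all? (c <?_) P) (<-asym c<y ∘ proj₁)) (sym (lastAbove-0 P y Y<y))
  ... | no  _   = refl
  drop-small {c} {y} P (x ∷ X) {Y} c<y = trans
    (cong (case? (all? (_<? y) (X ++ c ∷ Y)) _) (drop-small P X c<y))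
    (case?-⇔ (all? (_<? y) (X ++ c ∷ Y)) (all? (_<? y) (X ++ Y)) (mk⇔
      (λ <y → All.++⁺ (All.++⁻ˡ X <y) (All.tail (All.++⁻ʳ X <y)))
      (λ <y → All.++⁺ (All.++⁻ˡ X <y) (c<y ∷ All.++⁻ʳ X <y))))
  blocked : ∀ {c P} x {W} → c ∈ P → All (c <_) W → lastAbove P x W ≡ 0
  blocked x {[]} _ _ = refl
  blocked {P = P} x {y ∷ W} c∈P (c<y ∷ c<W) with all? (_<? x) W
  ... | yes _ = case?-no ((x <? y) ×-dec all? (y <?_) P) (∉-below c∈P c<y ∘ proj₂)
  ... | no  _ = blocked x c∈P c<W
  lower : ∀ {c} P {V} → All (c <_) V → lastAbove P c V ≡ lastAbove P 0 V
  lower P [] = refl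
  lower {c} P {y ∷ []} (c<y ∷ []) = case?-⇔ ((c <? y) ×-dec all? (y <?_) P) ((0 <? y) ×-dec all? (y <?_) P)
    (mk⇔ (λ (_ , y<P) → ≤-<-trans z≤n c<y , y<P) (λ (_ , y<P) → c<y , y<P))
  lower {c} P {y ∷ z ∷ V} (_ ∷ c<V@(c<z ∷ _)) = trans (case?-no (all? (_<? c) (z ∷ V)) λ { (z<c ∷ _) → <-asym c<z z<c })
    (lower P c<V)

firstAbove-head : ∀ {c L Y} → All (c <_) L → firstAbove L 0 (c ∷ Y) ≡ 1
firstAbove-head {c} {L} c<L = case?-yes (all? (c <?_) L) c<L

-- No letter is below 0, so for the hole the scan always runs to the last letter, and that letter
-- does not change while `c` has a letter behind it.
lastAbove-insert : ∀ {c L} X {y Y} → lastAbove L 0 (X ++ c ∷ y ∷ Y) ≡ lastAbove L 0 (X ++ y ∷ Y)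
lastAbove-insert []      = refl
lastAbove-insert {c} {L} (x ∷ X) {y} {Y} = trans (case?-no (all? (_<? 0) (X ++ c ∷ y ∷ Y)) (λ <0 → case All.++⁻ʳ X <0 of λ { (() ∷ _) }))
  (trans (lastAbove-insert X) (sym (case?-no (all? (_<? 0) (X ++ y ∷ Y)) (λ <0 → case All.++⁻ʳ X <0 of λ { (() ∷ _) }))))

-- Positivity of `c` is what makes it count as larger than the hole, which is represented by 0.
lastAbove-last : ∀ {c L} X → 0 < c → All (c <_) L → lastAbove L 0 (X ++ c ∷ []) ≡ 1
lastAbove-last {c} {L} []      0<c c<L = case?-yes ((0 <? c) ×-dec all? (c <?_) L) (0<c , c<L)
lastAbove-last {c} {L} (x ∷ X) 0<c c<L =
  trans (case?-no (all? (_<? 0) (X ++ c ∷ [])) (λ <0 → case All.++⁻ʳ X <0 of λ { (() ∷ _) })) (lastAbove-last X 0<c c<L)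

-- Sums of the statistics along mirrored insertion

module Total (e : List ℕ → ℕ → List ℕ → ℕ) where

  -- Only letters left of the hole, namely those of `L`, are summed. The letters of `V` may wait:
  -- when a fill moves them to the left of the hole, the filling letter blocks them.
  total : List ℕ → List ℕ → List ℕ → ℕ
  total P []      V = 0
  total P (x ∷ L) V = e P x (L ++ V) + total (P ∷ʳ x) L V

  module _ (stat : Statistic e) where
    open Statistic stat

    -- Every summed letter lies to the left of `c` and above it, so none of them notices the
    -- insertion.
    total-insert : ∀ {c} P {L} X {Y} → All (c <_) L → total P L (X ++ c ∷ Y) ≡ total P L (X ++ Y)
    total-insert P {[]}        X _           = refl
    total-insert {c} P {y ∷ L} X {Y} (c<y ∷ c<L) = cong₂ _+_
      (trans (cong (e P y) (sym (++-assoc L X (c ∷ Y))))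
        (trans (drop-small P (L ++ X) c<y) (cong (e P y) (++-assoc L X Y))))
      (total-insert (P ∷ʳ y) X c<L)

    total-blocked : ∀ {c P} L V → c ∈ P → All (c <_) (L ++ V) → total P L V ≡ 0
    total-blocked []      V _   _          = refl
    total-blocked (y ∷ L) V c∈P (_ ∷ c<) = cong₂ _+_ (blocked y c∈P c<) (total-blocked L V (∈-++⁺ˡ c∈P) c<)

    -- The letters of `L` ignore the smaller `c`, those of `X` are blocked by it, and so the only
    -- new summand is that of `c` itself.
    total-fill : ∀ {c} P L X {Y} → All (c <_) (L ++ X ++ Y) →
                 total P (L ++ c ∷ X) Y ≡ total P L (X ++ Y) + e (P ++ L) c (X ++ Y)
    total-fill {c} P [] X {Y} c< = trans (cong₂ _+_ (cong (λ Q → e Q c (X ++ Y)) (sym (++-identityʳ P)))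
      (total-blocked X Y (∈-++⁺ʳ P (here refl)) c<)) (+-identityʳ _)
    total-fill {c} P (y ∷ L) X {Y} (c<y ∷ c<) = trans
      (cong₂ _+_ (trans (cong (e P y) (++-assoc L (c ∷ X) Y)) (drop-small P L c<y))
                 (trans (total-fill (P ∷ʳ y) L X c<) (cong (λ Q → total (P ∷ʳ y) L (X ++ Y) + e Q c (X ++ Y)) (∷ʳ-++ P y L))))
      (sym (+-assoc (e P y (L ++ X ++ Y)) _ _))

open Total public

-- Besides the sums, the induction carries the value at the hole, which tells whether a letter
-- filling it now would contribute. Starting at `suc c` keeps all letters distinct from the 0 that
-- stands for the hole.
Mirror-total≡ : ∀ {k c L V L′ V′} → Mirror k (suc c) L V L′ V′ →
                total firstAbove [] L V ≡ total lastAbove [] L′ V′ × firstAbove L 0 V ≡ lastAbove L′ 0 V′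
Mirror-total≡ start = refl , refl
Mirror-total≡ {c = c₀} (insert {c = c} {L} {L′} X Y X′ Y′ |X| |Y| m) =
    trans (total-insert firstAbove firstAbove-statistic [] X c<L)
      (trans (proj₁ (Mirror-total≡ m)) (sym (total-insert lastAbove lastAbove-statistic [] X′ c<L′)))
  , hole X Y′ |X| (proj₂ (Mirror-total≡ m))
  where
  c<L  = All.++⁻ˡ L (Mirror-> m)
  c<L′ = All.++⁻ˡ L′ (Mirror-> (Mirror-sym m))
  hole : ∀ X Y′ → length X ≡ length Y′ → firstAbove L 0 (X ++ Y) ≡ lastAbove L′ 0 (X′ ++ Y′) →
         firstAbove L 0 (X ++ suc c₀ ∷ Y) ≡ lastAbove L′ 0 (X′ ++ suc c₀ ∷ Y′)
  -- Mirrored places: `c` is the first letter right of one hole exactly when it is the last letter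
  -- right of the other. Both values then become 1; otherwise both are unchanged.
  hole []      []       _ _  = trans (firstAbove-head {Y = Y} c<L) (sym (lastAbove-last X′ z<s c<L′))
  hole (x ∷ X) (y ∷ Y′) _ eq = trans eq (sym (lastAbove-insert X′))
Mirror-total≡ {c = c} (fill L L′ X Y X′ Y′ |X| |Y| m) =
    trans (total-fill firstAbove firstAbove-statistic [] L X c<)
      (trans (cong₂ _+_ (proj₁ (Mirror-total≡ m)) hole)
        (sym (total-fill lastAbove lastAbove-statistic [] L′ X′ c<′)))
  -- The filling letter is left of the new hole and below everything to its right, so both hole
  -- values restart at 0.
  , trans (Statistic.blocked firstAbove-statistic 0 (∈-insert L) (All.++⁻ʳ X (All.++⁻ʳ L c<)))
      (sym (Statistic.blocked lastAbove-statistic 0 (∈-insert L′) (All.++⁻ʳ X′ (All.++⁻ʳ L′ c<′))))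
  where
  c<  = Mirror-> m
  c<′ = Mirror-> (Mirror-sym m)
  hole : firstAbove L (suc c) (X ++ Y) ≡ lastAbove L′ (suc c) (X′ ++ Y′)
  -- The filling letter contributes exactly the value previously carried by the hole, and these
  -- values agree by induction.
  hole = trans (Statistic.lower firstAbove-statistic L (All.++⁻ʳ L c<))
    (trans (proj₂ (Mirror-total≡ m)) (sym (Statistic.lower lastAbove-statistic L′ (All.++⁻ʳ L′ c<′))))

-- Counting occurrences by their lower letter

count : {P : A → Set} → Decidable P → List A → ℕ
count P? xs = length (filter P? xs)

count-∷ : {P : A → Set} (P? : Decidable P) → ∀ x xs → count P? (x ∷ xs) ≡ case? (P? x) 1 0 + count P? xs
count-∷ P? x xs with P? x
... | yes _ = refl
... | no  _ = refl

count-++ : {P : A → Set} (P? : Decidable P) → ∀ xs {ys} → count P? (xs ++ ys) ≡ count P? xs + count P? ys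
count-++ P? xs {ys} = trans (cong length (filter-++ P? xs ys)) (length-++ (filter P? xs))

count-none : {P : A → Set} (P? : Decidable P) {xs : List A} → (∀ {x} → x ∈ xs → ¬ P x) → count P? xs ≡ 0
count-none P? {[]}     _  = refl
count-none P? {x ∷ xs} ¬P = trans (count-∷ P? x xs) (cong₂ _+_ (case?-no (P? x) (¬P (here refl))) (count-none P? (¬P ∘ there)))

count-map : {P : B → Set} (P? : Decidable P) (f : A → B) → ∀ xs → count P? (map f xs) ≡ count (P? ∘ f) xs
count-map P? f []       = refl
count-map P? f (x ∷ xs) = trans (count-∷ P? (f x) (map f xs))
  (trans (cong (case? (P? (f x)) 1 0 +_) (count-map P? f xs)) (sym (count-∷ (P? ∘ f) x xs)))

count-cartesianProduct : {P : A × B → Set} (P? : Decidable P) → ∀ xs ys →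
  count P? (cartesianProduct xs ys) ≡ sum (map (λ x → count (λ y → P? (x , y)) ys) xs)
count-cartesianProduct P? []       ys = refl
count-cartesianProduct P? (x ∷ xs) ys = trans (count-++ P? (map (x ,_) ys))
  (cong₂ _+_ (count-map P? (x ,_) ys) (count-cartesianProduct P? xs ys))

partners : Shading → List ℕ → ℕ × ℕ → List (ℕ × ℕ) → ℕ
partners R w p = count (λ q → T? (isOcc R w p q))

Tallies : (List ℕ → ℕ → List ℕ → ℕ) → Shading → Set
Tallies e R = ∀ {n} P x W → IsPerm n (P ++ x ∷ W) →
              partners R (P ++ x ∷ W) (suc (length P) , x) (points 1 (P ++ x ∷ W)) ≡ e P x W

-- Occurrences are grouped by their lower point, from left to right. In a complete permutation the
-- hole is at the right end, whence the empty last argument of `total`.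
occ≡total : ∀ {e} R {n w} → Tallies e R → IsPerm n w → occ R w ≡ total e [] w []
occ≡total {e} R {n} {w} tallies π = trans (occ≡ R w) (trans (count-cartesianProduct _ (points 1 w) (points 1 w)) (go [] w refl))
  where
  go : ∀ P W → P ++ W ≡ w →
       sum (map (λ p → partners R w p (points 1 w)) (points (suc (length P)) W)) ≡ total e P W []
  go P []      _    = refl
  go P (x ∷ W) refl = cong₂ _+_ (trans (tallies P x W π) (cong (e P x) (sym (++-identityʳ W))))
    (trans (cong (λ l → sum (map (λ p → partners R w p (points 1 w)) (points (suc l) W)))
             (trans (+-comm 1 (length P)) (sym (length-++ P))))
           (go (P ∷ʳ x) W (∷ʳ-++ P x W)))

∈-points-++⁺ˡ : ∀ {c u w p} → p ∈ points c u → p ∈ points c (u ++ w)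
∈-points-++⁺ˡ {c} {u} p∈ = subst (_ ∈_) (sym (points-++ c u)) (∈-++⁺ˡ p∈)

∈-points-++⁺ʳ : ∀ {c} u {w p} → p ∈ points (c + length u) w → p ∈ points c (u ++ w)
∈-points-++⁺ʳ {c} u p∈ = subst (_ ∈_) (sym (points-++ c u)) (∈-++⁺ʳ (points c u) p∈)

∈-points-++⁻ˡ : ∀ {c} u {w k v} → (k , v) ∈ points c (u ++ w) → k < c + length u → (k , v) ∈ points c u
∈-points-++⁻ˡ {c} u {w} p∈ k< with ∈-++⁻ (points c u) (subst (_ ∈_) (points-++ c u) p∈)
... | inj₁ p∈u = p∈u
... | inj₂ p∈w = contradiction k< (≤⇒≯ (proj₁ (proj₁ (∈-points⁻ p∈w))))

∈-points-++⁻ʳ : ∀ {c} u {w k v} → (k , v) ∈ points c (u ++ w) → c + length u ≤ k → (k , v) ∈ points (c + length u) w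
∈-points-++⁻ʳ {c} u {w} p∈ ≤k with ∈-++⁻ (points c u) (subst (_ ∈_) (points-++ c u) p∈)
... | inj₁ p∈u = contradiction (proj₂ (proj₁ (∈-points⁻ p∈u))) (≤⇒≯ ≤k)
... | inj₂ p∈w = p∈w

∈-points-∷⁻ : ∀ {c x w k v} → (k , v) ∈ points c (x ∷ w) → c < k → (k , v) ∈ points (suc c) w
∈-points-∷⁻ (here refl) c<c = contradiction c<c (<-irrefl refl)
∈-points-∷⁻ (there p∈)  _   = p∈

-- Local form of the occurrences of R₂ and R₅

module Decomposition {n} (P : List ℕ) (x : ℕ) (W₁ : List ℕ) (y : ℕ) (W₂ : List ℕ)
                     (π : IsPerm n (P ++ x ∷ W₁ ++ y ∷ W₂)) where

  w = P ++ x ∷ W₁ ++ y ∷ W₂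
  i = suc (length P)
  j = suc i + length W₁

  column : Fin 3 → List ℕ
  column 0F = P
  column 1F = W₁
  column 2F = W₂

  ∈-column⁻ : ∀ a {k v} → (k , v) ∈ points 1 w → Strip (cuts n i j) a k → v ∈ column a
  ∈-column⁻ 0F p∈ (_ , k<i) = proj₂ (∈-points⁻ (∈-points-++⁻ˡ P p∈ k<i))
  ∈-column⁻ 1F p∈ (i<k , k<j) =
    proj₂ (∈-points⁻ (∈-points-++⁻ˡ W₁ (∈-points-∷⁻ (∈-points-++⁻ʳ P p∈ (<⇒≤ i<k)) i<k) k<j))
  ∈-column⁻ 2F p∈ (j<k , _) =
    proj₂ (∈-points⁻ (∈-points-∷⁻ (∈-points-++⁻ʳ W₁ (∈-points-∷⁻ (∈-points-++⁻ʳ P p∈ (<⇒≤ i<k)) i<k) (<⇒≤ j<k)) j<k))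
    where i<k = ≤-<-trans (m≤m+n i (length W₁)) (<-trans (n<1+n _) j<k)

  ∈-column⁺ : ∀ a {v} → v ∈ column a → ∃ λ k → (k , v) ∈ points 1 w × Strip (cuts n i j) a k
  ∈-column⁺ 0F v∈ with ∈-points⁺ {1} v∈
  ... | k , p∈ = k , ∈-points-++⁺ˡ p∈ , proj₁ (∈-points⁻ p∈)
  ∈-column⁺ 1F v∈ with ∈-points⁺ {suc i} v∈
  ... | k , p∈ = k , ∈-points-++⁺ʳ P (there (∈-points-++⁺ˡ p∈)) , proj₁ (∈-points⁻ p∈)
  ∈-column⁺ 2F v∈ with ∈-points⁺ {suc j} v∈
  ... | k , p∈ = k , p∈w , proj₁ (proj₁ (∈-points⁻ p∈)) , s≤s (proj₂ (proj₁ (points⇒InSquare π p∈w)))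
    where p∈w = ∈-points-++⁺ʳ P (there (∈-points-++⁺ʳ W₁ (there p∈)))

  column⊆w : ∀ a {v} → v ∈ column a → v ∈ w
  column⊆w a v∈ = proj₂ (∈-points⁻ (proj₁ (proj₂ (∈-column⁺ a v∈))))

  column≢ : ∀ a {v} → v ∈ column a → v ≢ x × v ≢ y
  column≢ a v∈ = (λ { refl → x∉ (⊆x a v∈) }) , (λ { refl → y∉ (⊆y a v∈) })
    where
    w! = IsPerm-Unique π
    x∉ : x ∉ P ++ W₁ ++ y ∷ W₂
    x∉ = Unique-++-∷⇒∉ P w!
    y∉ : y ∉ (P ++ x ∷ W₁) ++ W₂
    y∉ = Unique-++-∷⇒∉ (P ++ x ∷ W₁) (subst Unique (sym (++-assoc P (x ∷ W₁) (y ∷ W₂))) w!)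
    ⊆x : ∀ a {v} → v ∈ column a → v ∈ P ++ W₁ ++ y ∷ W₂
    ⊆x 0F v∈ = ∈-++⁺ˡ v∈
    ⊆x 1F v∈ = ∈-++⁺ʳ P (∈-++⁺ˡ v∈)
    ⊆x 2F v∈ = ∈-++⁺ʳ P (∈-++⁺ʳ W₁ (there v∈))
    ⊆y : ∀ a {v} → v ∈ column a → v ∈ (P ++ x ∷ W₁) ++ W₂
    ⊆y 0F v∈ = ∈-++⁺ˡ (∈-++⁺ˡ v∈)
    ⊆y 1F v∈ = ∈-++⁺ˡ (∈-++⁺ʳ P (there v∈))
    ⊆y 2F v∈ = ∈-++⁺ʳ (P ++ x ∷ W₁) v∈

  -- `1F` gives `R-first` and `2F` gives `R-last`, so both are treated at once.
  shading : Fin 3 → Shading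
  shading a = (a , 2F) ∷ (0F , 1F) ∷ (a , 1F) ∷ (0F , 0F) ∷ []

  -- The two shaded boxes of column 0 forbid letters below `y` in `P`; the two of column `a` forbid
  -- letters above `x` there. Letters on the mesh lines do not interfere, because `x` and `y` occur
  -- only once.
  isOcc⇔ : ∀ a → T (isOcc (shading a) w (i , x) (j , y)) ⇔ ((x < y × All (y <_) P) × All (_< x) (column a))
  isOcc⇔ a = mk⇔ f g
    where
    f : T (isOcc (shading a) w (i , x) (j , y)) → (x < y × All (y <_) P) × All (_< x) (column a)
    f t = (val< o , All.tabulate above) , All.tabulate below
      where
      o = to (isOcc⇔Occ π (shading a) (i , x) (j , y)) t
      outside : ∀ {a′ b v} → (a′ , b) ∈ shading a → v ∈ column a′ → ¬ Strip (cuts n x y) b v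
      outside {a′} ab∈ v∈ = let k , p∈ , k∈ = ∈-column⁺ a′ v∈ in empty o ab∈ p∈ k∈
      above : ∀ {v} → v ∈ P → y < v
      above {v} v∈ with <-cmp v y | <-cmp v x | column≢ 0F v∈
      ... | tri> _ _ y<v | _            | _       = y<v
      ... | tri≈ _ v≡y _ | _            | _ , v≢y = contradiction v≡y v≢y
      ... | _            | tri≈ _ v≡x _ | v≢x , _ = contradiction v≡x v≢x
      ... | tri< v<y _ _ | tri> _ _ x<v | _       = contradiction (x<v , v<y) (outside (there (here refl)) v∈)
      ... | tri< _ _ _   | tri< v<x _ _ | _       =
        contradiction (proj₁ (IsPerm-∈ π (column⊆w 0F v∈)) , v<x) (outside (there (there (there (here refl)))) v∈)
      below : ∀ {v} → v ∈ column a → v < x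
      below {v} v∈ with <-cmp v x | <-cmp v y | column≢ a v∈
      ... | tri< v<x _ _ | _            | _       = v<x
      ... | tri≈ _ v≡x _ | _            | v≢x , _ = contradiction v≡x v≢x
      ... | _            | tri≈ _ v≡y _ | _ , v≢y = contradiction v≡y v≢y
      ... | tri> _ _ x<v | tri< v<y _ _ | _       = contradiction (x<v , v<y) (outside (there (there (here refl))) v∈)
      ... | tri> _ _ _   | tri> _ _ y<v | _       =
        contradiction (y<v , s≤s (proj₂ (IsPerm-∈ π (column⊆w a v∈)))) (outside (here refl) v∈)
    g : (x < y × All (y <_) P) × All (_< x) (column a) → T (isOcc (shading a) w (i , x) (j , y))
    g ((x<y , y<P) , <x) = from (isOcc⇔Occ π (shading a) (i , x) (j , y))
      (mkOcc (m≤m+n (suc i) (length W₁)) x<y λ {a′} ab∈ p∈ k∈ → outside ab∈ (∈-column⁻ a′ p∈ k∈))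
      where
      outside : ∀ {a′ b v} → (a′ , b) ∈ shading a → v ∈ column a′ → ¬ Strip (cuts n x y) b v
      outside (here refl)                         v∈ (y<v , _) = <-asym y<v (<-trans (All.lookup <x v∈) x<y)
      outside (there (here refl))                 v∈ (_ , v<y) = <-asym v<y (All.lookup y<P v∈)
      outside (there (there (here refl)))         v∈ (x<v , _) = <-asym x<v (All.lookup <x v∈)
      outside (there (there (there (here refl)))) v∈ (_ , v<x) = <-asym v<x (<-trans x<y (All.lookup y<P v∈))

R-first R-last : Shading
R-first = b 1 2 ∷ b 0 1 ∷ b 1 1 ∷ b 0 0 ∷ []
R-last  = b 2 2 ∷ b 0 1 ∷ b 2 1 ∷ b 0 0 ∷ []

module Partners {n} (P : List ℕ) (x : ℕ) (W : List ℕ) (π : IsPerm n (P ++ x ∷ W)) where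

  w = P ++ x ∷ W
  i = suc (length P)

  partners≡ : ∀ R → partners R w (i , x) (points 1 w) ≡ partners R w (i , x) (points (suc i) W)
  partners≡ R = trans (cong (partners R w (i , x)) (points-++ 1 P))
    (trans (count-++ T-isOcc? (points 1 P)) (cong₂ _+_
      (count-none T-isOcc? {points 1 P} λ {(k , v)} p∈ → not-left k v (<⇒≤ (proj₂ (proj₁ (∈-points⁻ {w = P} p∈)))))
      (trans (count-∷ T-isOcc? (i , x) (points (suc i) W)) (cong (_+ partners R w (i , x) (points (suc i) W)) (case?-no (T-isOcc? (i , x)) (not-left i x ≤-refl))))))
    where
    T-isOcc? : Decidable (λ q → T (isOcc R w (i , x) q))
    T-isOcc? q = T? (isOcc R w (i , x) q)
    not-left : ∀ k v → k ≤ i → ¬ T (isOcc R w (i , x) (k , v))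
    not-left k v k≤i t = <⇒≱ (pos< (to (isOcc⇔Occ π R (i , x) (k , v)) t)) k≤i

  module Suffix (W₁ : List ℕ) (y : ℕ) (W₂ : List ℕ) (W≡ : W ≡ W₁ ++ y ∷ W₂) where

    π′ : IsPerm n (P ++ x ∷ W₁ ++ y ∷ W₂)
    π′ = subst (λ W → IsPerm n (P ++ x ∷ W)) W≡ π

    open Decomposition P x W₁ y W₂ π′ public using (column; shading)

    Occurs : Fin 3 → List ℕ → Set
    Occurs a W = T (isOcc (shading a) (P ++ x ∷ W) (i , x) (suc i + length W₁ , y))

    isOcc⇔ : ∀ a → Occurs a W ⇔ ((x < y × All (y <_) P) × All (_< x) (column a))
    isOcc⇔ a = subst (λ W → Occurs a W ⇔ ((x < y × All (y <_) P) × All (_< x) (column a))) (sym W≡)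
      (Decomposition.isOcc⇔ P x W₁ y W₂ π′ a)

    x≢y : x ≢ y
    x≢y x≡y = Unique-++-∷⇒∉ P (IsPerm-Unique π′) (subst (_∈ P ++ W₁ ++ y ∷ W₂) (sym x≡y) (∈-++⁺ʳ P (∈-insert W₁)))

    partners-∷ : ∀ a → partners (shading a) w (i , x) (points (suc i + length W₁) (y ∷ W₂)) ≡
      case? (((x <? y) ×-dec all? (y <?_) P) ×-dec all? (_<? x) (column a)) 1 0 +
      partners (shading a) w (i , x) (points (suc i + length (W₁ ∷ʳ y)) W₂)
    partners-∷ a = trans (count-∷ _ (suc i + length W₁ , y) (points (suc (suc i + length W₁)) W₂))
      (cong₂ _+_ (case?-⇔ (T? (isOcc (shading a) w (i , x) (suc i + length W₁ , y)))
               (((x <? y) ×-dec all? (y <?_) P) ×-dec all? (_<? x) (column a)) (isOcc⇔ a))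
        (cong (λ m → partners (shading a) w (i , x) (points m W₂))
          (trans (sym (+-suc (suc i) (length W₁))) (cong (suc i +_) (trans (+-comm 1 (length W₁)) (sym (length-++ W₁)))))))

    next : W ≡ (W₁ ∷ʳ y) ++ W₂
    next = trans W≡ (sym (∷ʳ-++ W₁ y W₂))

  -- For `R-first`, a letter of `W₁` that is not below `x` lies in column 1 of every later candidate
  -- and rules it out.
  first-none : ∀ W₁ W₂ → W ≡ W₁ ++ W₂ → ¬ All (_< x) W₁ →
               partners R-first w (i , x) (points (suc i + length W₁) W₂) ≡ 0
  first-none W₁ []       _  _   = refl
  first-none W₁ (y ∷ W₂) W≡ W₁≮ = trans (partners-∷ 1F)
    (cong₂ _+_ (case?-no (((x <? y) ×-dec all? (y <?_) P) ×-dec all? (_<? x) W₁) (W₁≮ ∘ proj₂))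
               (first-none (W₁ ∷ʳ y) W₂ next (W₁≮ ∘ All.++⁻ˡ W₁)))
    where open Suffix W₁ y W₂ W≡

  -- `W₁` is the part already scanned. While it stays below `x`, the scan of `firstAbove` can go on;
  -- after the first larger letter `first-none` disposes of the rest.
  first≡ : ∀ W₁ W₂ → W ≡ W₁ ++ W₂ → All (_< x) W₁ →
           partners R-first w (i , x) (points (suc i + length W₁) W₂) ≡ firstAbove P x W₂
  first≡ W₁ []       _  _   = refl
  first≡ W₁ (y ∷ W₂) W≡ W₁< with y <? x
  ... | yes y<x = trans (partners-∷ 1F) (trans
    (cong₂ _+_ (case?-no (((x <? y) ×-dec all? (y <?_) P) ×-dec all? (_<? x) W₁) (<-asym y<x ∘ proj₁ ∘ proj₁))
               (first≡ (W₁ ∷ʳ y) W₂ next (All.∷ʳ⁺ W₁< y<x)))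
    (sym (case?-yes (y <? x) y<x)))
    where open Suffix W₁ y W₂ W≡
  ... | no y≮x = trans (partners-∷ 1F) (trans
    (cong₂ _+_ (case?-⇔ (((x <? y) ×-dec all? (y <?_) P) ×-dec all? (_<? x) W₁) (all? (y <?_) P)
                 (mk⇔ (proj₂ ∘ proj₁) (λ y<P → (x<y , y<P) , W₁<)))
               (first-none (W₁ ∷ʳ y) W₂ next (y≮x ∘ proj₂ ∘ All.∷ʳ⁻)))
    (trans (+-identityʳ _) (sym (case?-no (y <? x) y≮x))))
    where
    open Suffix W₁ y W₂ W≡
    x<y = ≤∧≢⇒< (≮⇒≥ y≮x) x≢y

  -- Here column 2 is the part not yet scanned, so nothing has to be remembered about `W₁`.
  last≡ : ∀ W₁ W₂ → W ≡ W₁ ++ W₂ →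
          partners R-last w (i , x) (points (suc i + length W₁) W₂) ≡ lastAbove P x W₂
  last≡ W₁ []       _  = refl
  last≡ W₁ (y ∷ W₂) W≡ with all? (_<? x) W₂
  ... | yes W₂< = trans (partners-∷ 2F) (trans
    (cong₂ _+_ (case?-⇔ (((x <? y) ×-dec all? (y <?_) P) ×-dec all? (_<? x) W₂) ((x <? y) ×-dec all? (y <?_) P)
                 (mk⇔ proj₁ (_, W₂<)))
               (trans (last≡ (W₁ ∷ʳ y) W₂ next) (lastAbove-0 P x W₂<)))
    (+-identityʳ _))
    where open Suffix W₁ y W₂ W≡
  ... | no W₂≮ = trans (partners-∷ 2F)
    (cong₂ _+_ (case?-no (((x <? y) ×-dec all? (y <?_) P) ×-dec all? (_<? x) W₂) (W₂≮ ∘ proj₂))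
               (last≡ (W₁ ∷ʳ y) W₂ next))
    where open Suffix W₁ y W₂ W≡

firstAbove-tallies : Tallies firstAbove R-first
firstAbove-tallies P x W π = trans (partners≡ R-first)
  (trans (cong (λ m → partners R-first w (i , x) (points m W)) (sym (+-identityʳ (suc i)))) (first≡ [] W refl []))
  where open Partners P x W π

lastAbove-tallies : Tallies lastAbove R-last
lastAbove-tallies P x W π = trans (partners≡ R-last)
  (trans (cong (λ m → partners R-last w (i , x) (points m W)) (sym (+-identityʳ (suc i)))) (last≡ [] W refl))
  where open Partners P x W π

equidistributed-first-last : Equidistributed R-first R-last
equidistributed-first-last n = s-≡ R-first R-last M M-total
  (λ (π , π′ , m) → π′ , π , Mirror-sym m)
  (λ (_ , _ , m) (_ , _ , m′) → proj₁ (Mirror-injective m m′ refl refl))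
  (λ (π , π′ , m) → trans (occ≡total R-first firstAbove-tallies π)
    (trans (proj₁ (Mirror-total≡ m)) (sym (occ≡total R-last lastAbove-tallies π′))))
  where
  -- A complete permutation is a word whose hole stands at the right end.
  M : List ℕ → List ℕ → Set
  M w w′ = IsPerm n w × IsPerm n w′ × Mirror n 1 w [] w′ []
  M-total : ∀ {w} → IsPerm n w → ∃ λ w′ → IsPerm n w′ × M w w′
  M-total {w} π with Mirror-total n 1 w [] (subst (_↭ range 1 n) (sym (++-identityʳ w)) π)
  -- The right part of the image is as long as that of `w`, hence empty.
  ... | w′ , [] , m , _ = w′ , π′ , π , π′ , m
    where π′ = subst (_↭ range 1 n) (++-identityʳ w′) (Mirror-↭ (Mirror-sym m))

-- Joining the six shadings

open DecMembership (Product.≡-dec (Fin._≟_ {3}) (Fin._≟_ {3})) using (_∈?_)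

image⊆? : (f : Fin 3 × Fin 3 → Fin 3 × Fin 3) (R R′ : Shading) → Dec (All (λ r → f r ∈ R′) R)
image⊆? f R R′ = all? (λ r → f r ∈? R′) R

-- The implicit arguments let evaluation of a decision procedure on closed shadings check that
-- transposing the boxes maps each shading into the other.
by-inverse : ∀ R R′ {_ : True (image⊆? swap R′ R)} {_ : True (image⊆? swap R R′)} → Equidistributed R R′
by-inverse R R′ {p} {q} = equidistributed-inverse R R′
  (All.lookup (toWitness {a? = image⊆? swap R′ R} p)) (All.lookup (toWitness {a? = image⊆? swap R R′} q))

rotate : Fin 3 × Fin 3 → Fin 3 × Fin 3
rotate (a , b) = opposite a , opposite b

by-reverse-complement : ∀ R R′ {_ : True (image⊆? rotate R′ R)} {_ : True (image⊆? rotate R R′)} → Equidistributed R R′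
by-reverse-complement R R′ {p} {q} =
  equidistributed-reverse-complement R R′
    (All.lookup (toWitness {a? = image⊆? rotate R′ R} p)) (All.lookup (toWitness {a? = image⊆? rotate R R′} q))

equidistributed-sym : ∀ R R′ → Equidistributed R R′ → Equidistributed R′ R
equidistributed-sym _ _ e n k = sym (e n k)

equidistributed-trans : ∀ R R′ R″ → Equidistributed R R′ → Equidistributed R′ R″ → Equidistributed R R″
equidistributed-trans _ _ _ e e′ n k = trans (e n k) (e′ n k)

-- `R-last`, the fifth shading, is the common target. Inverse joins the first to the third, the
-- fourth to the second and the sixth to the fifth; reverse-complement joins the third to the
-- second, and mirrored insertion the second to the fifth.
equidistributed-R-last : All (λ R → Equidistributed R R-last) sixShadings
equidistributed-R-last = R₁~ ∷ R₂~ ∷ R₃~ ∷ R₄~ ∷ (λ _ _ → refl) ∷ by-inverse R₆ R-last ∷ []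
  where
  R₁ = b 1 2 ∷ b 2 2 ∷ b 0 1 ∷ b 1 1 ∷ []
  R₃ = b 2 2 ∷ b 1 1 ∷ b 2 1 ∷ b 1 0 ∷ []
  R₄ = b 1 1 ∷ b 2 1 ∷ b 0 0 ∷ b 1 0 ∷ []
  R₆ = b 1 2 ∷ b 2 2 ∷ b 0 0 ∷ b 1 0 ∷ []
  R₂~ = equidistributed-first-last
  R₃~ = equidistributed-trans R₃ R-first R-last (by-reverse-complement R₃ R-first) R₂~
  R₄~ = equidistributed-trans R₄ R-first R-last (by-inverse R₄ R-first) R₂~
  R₁~ = equidistributed-trans R₁ R₃ R-last (by-inverse R₁ R₃) R₃~

theorem6p2 : ∀ R₁ R₂ → R₁ ∈ sixShadings → R₂ ∈ sixShadings → Equidistributed R₁ R₂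
theorem6p2 R₁ R₂ R₁∈ R₂∈ = equidistributed-trans R₁ R-last R₂ (All.lookup equidistributed-R-last R₁∈)
  (equidistributed-sym R₂ R-last (All.lookup equidistributed-R-last R₂∈))
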